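{- $\mathrm{PWPP}(n,n-1)$ polynomial-time reduces to \textsc{Unary Long Choice}.
   Context: All circuits are Boolean circuits of size polynomial in $n$. A search problem $A$ polynomial-time reduces to a search problem $B$ if there are polynomial-time computable maps $f,g$ such that for every instance $I$ of $A$, $f(I)$ is an instance of $B$, and for every solution $s$ of $f(I)$, $g(I,s)$ is a solution of $I$. $\mathrm{PWPP}(n,m)$ (for $m<n$): given a poly($n$)-size circuit $C:\{0,1\}^n\to\{0,1\}^m$, find $x\neq y$ with $C(x)=C(y)$. \textsc{Unary Long Choice}: Let $U=\{0,1\}^n$. The input is a sequence of predicates $P_0,\dots,P_{n-2}$ given by poly($n$)-size circuits, where $P_i:U^{i+2}\to\{0,1\}$ and the value $P_i(a_0,\dots,a_i,x)$ depends only on the last argument $x$ (equivalently, each $P_i$ is given as a circuit $U\to\{0,1\}$ applied to the last argument). A solution is a sequence of $n+1$ distinct elements $a_0,\dots,a_n\in U$ such that for every $i\in\{0,\dots,n-2\}$, $P_i(a_0,\dots,a_i,a_j)$ is the same for all $j>i$. -}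

module Defs where

open import Data.Bool using (Bool; true; false; _∧_; _∨_; not)
open import Data.Fin using (Fin; zero; suc; toℕ)
open import Data.List as List using (List; []; _∷_; _++_)
open import Data.List.Properties as List using (++-assoc)
open import Data.Maybe using (Maybe; just; nothing)
open import Data.Nat using (ℕ; zero; suc; _+_; _*_; _∸_; _≤_; _<_)
open import Data.Product using (Σ; Σ-syntax; ∃-syntax; _×_; _,_; proj₁; proj₂)
open import Data.Vec as Vec using (Vec; []; _∷_; lookup)
open import Data.Vec.Relation.Unary.Unique.Propositional using (Unique)
open import Function using (_∘_)
open import Function.Definitions using (Injective)
open import Relation.Binary.PropositionalEquality

Bits : Set
Bits = List Bool

-- Polynomials with natural coefficients, constant coefficient first.

Poly : Set
Poly = List ℕ

⟦_⟧ : Poly → ℕ → ℕ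
⟦ [] ⟧    n = 0
⟦ a ∷ p ⟧ n = a + n * ⟦ p ⟧ n

-- `nothing` is the blank symbol.

Cell : Set
Cell = Maybe Bool

data Move : Set where
  left stay right : Move

-- A two-way infinite tape, blank beyond both lists.  The cell next to the
-- head comes first in each list.

record Tape : Set where
  constructor tape
  field
    before : List Cell
    head   : Cell
    after  : List Cell

initialTape : Bits → Tape
initialTape []       = tape [] nothing []
initialTape (b ∷ bs) = tape [] (just b) (List.map just bs)

write : Cell → Tape → Tape
write c (tape ls _ rs) = tape ls c rs

move : Move → Tape → Tape
move stay  t                    = t
move left  (tape [] c rs)       = tape [] nothing (c ∷ rs)
move left  (tape (l ∷ ls) c rs) = tape ls l (c ∷ rs)
move right (tape ls c [])       = tape (c ∷ ls) nothing []
move right (tape ls c (r ∷ rs)) = tape (c ∷ ls) r rs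

untilBlank : List Cell → Bits
untilBlank []             = []
untilBlank (nothing ∷ cs) = []
untilBlank (just b ∷ cs)  = b ∷ untilBlank cs

-- The string that starts under the head and extends to the first blank.

contents : Tape → Bits
contents (tape _ c rs) = untilBlank (c ∷ rs)

-- A machine with k input tapes.  Tape 0 is the output tape, tapes 1, …, k
-- hold the inputs, and the remaining tapes are work tapes.  The machine
-- halts when its transition function is undefined.

record TM (k : ℕ) : Set where
  field
    work   : ℕ
    states : ℕ
    start  : Fin states

  tapes : ℕ
  tapes = suc (k + work)

  field
    δ : Fin states → Vec Cell tapes →
        Maybe (Fin states × Vec (Cell × Move) tapes)

module _ {k : ℕ} (M : TM k) where
  open TM M

  Config : Set
  Config = Fin states × Vec Tape tapes

  initial : Vec Bits k → Config
  initial ws =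
    start , initialTape [] ∷ Vec.map initialTape ws Vec.++ Vec.replicate work (initialTape [])

  act : Cell × Move → Tape → Tape
  act (c , d) t = move d (write c t)

  step : Config → Maybe Config
  step (q , ts) with δ q (Vec.map Tape.head ts)
  ... | nothing       = nothing
  ... | just (r , as) = just (r , Vec.zipWith act as ts)

  output : Config → Bits
  output (_ , t ∷ _) = contents t

  -- HaltsIn t c d : started in c, the machine halts in d after exactly t steps.

  data HaltsIn : ℕ → Config → Config → Set where
    halt : ∀ {c} → step c ≡ nothing → HaltsIn 0 c c
    next : ∀ {t c c′ d} → step c ≡ just c′ → HaltsIn t c′ d → HaltsIn (suc t) c d

totalLength : ∀ {k} → Vec Bits k → ℕ
totalLength = Vec.sum ∘ Vec.map List.length

-- A map on D whose arguments are presented as the strings `inputs d` and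
-- whose value is presented as the string `value d` is polynomial-time
-- computable.

PolyTime : ∀ {k} {D : Set} → (D → Vec Bits k) → (D → Bits) → Set
PolyTime {k} {D} inputs value =
  Σ[ M ∈ TM k ] Σ[ p ∈ Poly ] ∀ (d : D) →
    ∃[ t ] ∃[ c ] (HaltsIn M t (initial M (inputs d)) c
                 × output M c ≡ value d
                 × t ≤ ⟦ p ⟧ (totalLength (inputs d)))

-- `Candidate I` is the set of syntactically possible answers to I, and
-- `Solves I` singles out the solutions.

record SearchProblem : Set₁ where
  field
    Instance  : Set
    Candidate : Instance → Set
    Solves    : (I : Instance) → Candidate I → Set

    encode           : Instance → Bits
    encodeCandidate  : (I : Instance) → Candidate I → Bits
    encode-injective : Injective _≡_ _≡_ encode
    encodeCandidate-injective : ∀ I → Injective _≡_ _≡_ (encodeCandidate I)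

record _≤ₚ_ (A B : SearchProblem) : Set where
  private
    module A = SearchProblem A
    module B = SearchProblem B
  field
    f : A.Instance → B.Instance
    g : (I : A.Instance) → B.Candidate (f I) → A.Candidate I

    f-polyTime : PolyTime (λ I → A.encode I ∷ []) (B.encode ∘ f)
    g-polyTime : PolyTime {D = Σ A.Instance (B.Candidate ∘ f)}
                   (λ (I , s) → A.encode I ∷ B.encodeCandidate (f I) s ∷ [])
                   (λ (I , s) → A.encodeCandidate I (g I s))

    correct : ∀ I s → B.Solves (f I) s → A.Solves I (g I s)

infix 4 _≤ₚ_

data Gate (w : ℕ) : Set where
  and or : Fin w → Fin w → Gate w
  neg    : Fin w → Gate w

-- Gates w v extends w wires to v wires.  The output of each gate becomes
-- wire 0, and the index of every earlier wire goes up by one.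

data Gates : ℕ → ℕ → Set where
  []  : ∀ {w} → Gates w w
  _∷_ : ∀ {w v} → Gate w → Gates (suc w) v → Gates w v

record Circuit (n m : ℕ) : Set where
  constructor circuit
  field
    {wires} : ℕ
    gates   : Gates n wires
    outputs : Vec (Fin wires) m

evalGate : ∀ {w} → Gate w → Vec Bool w → Bool
evalGate (and i j) ws = lookup ws i ∧ lookup ws j
evalGate (or i j)  ws = lookup ws i ∨ lookup ws j
evalGate (neg i)   ws = not (lookup ws i)

evalGates : ∀ {w v} → Gates w v → Vec Bool w → Vec Bool v
evalGates []       ws = ws
evalGates (g ∷ gs) ws = evalGates gs (evalGate g ws ∷ ws)

eval : ∀ {n m} → Circuit n m → Vec Bool n → Vec Bool m
eval (circuit gs os) x = Vec.map (lookup (evalGates gs x)) os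

countGates : ∀ {w v} → Gates w v → ℕ
countGates []       = 0
countGates (_ ∷ gs) = suc (countGates gs)

size : ∀ {n m} → Circuit n m → ℕ
size = countGates ∘ Circuit.gates

-- Numbers are coded in unary, so that the code of an instance has length at
-- least n and polynomial time means time polynomial in n.

encodeℕ : ℕ → Bits
encodeℕ zero    = false ∷ []
encodeℕ (suc n) = true ∷ encodeℕ n

encodeFin : ∀ {w} → Fin w → Bits
encodeFin = encodeℕ ∘ toℕ

encodeGate : ∀ {w} → Gate w → Bits
encodeGate (neg i)   = false ∷ encodeFin i
encodeGate (and i j) = true ∷ false ∷ encodeFin i ++ encodeFin j
encodeGate (or i j)  = true ∷ true ∷ encodeFin i ++ encodeFin j

encodeGates : ∀ {w v} → Gates w v → Bits
encodeGates []       = false ∷ []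
encodeGates (g ∷ gs) = true ∷ encodeGate g ++ encodeGates gs

-- The length is not recorded: it is always known from the context.

encodeVec : ∀ {A : Set} {n} → (A → Bits) → Vec A n → Bits
encodeVec e []       = []
encodeVec e (x ∷ xs) = e x ++ encodeVec e xs

encodeCircuit : ∀ {n m} → Circuit n m → Bits
encodeCircuit (circuit gs os) = encodeGates gs ++ encodeVec encodeFin os

PrefixFree : {A : Set} → (A → Bits) → Set
PrefixFree {A} e = ∀ (a b : A) {x y} → e a ++ x ≡ e b ++ y → a ≡ b × x ≡ y

prefixFree⇒injective : {A : Set} {e : A → Bits} → PrefixFree e → Injective _≡_ _≡_ e
prefixFree⇒injective pf {a} {b} eq = proj₁ (pf a b (cong (_++ []) eq))

reassoc : ∀ (a c : Bits) {b d x y} →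
          (a ++ b) ++ x ≡ (c ++ d) ++ y → a ++ b ++ x ≡ c ++ d ++ y
reassoc a c {b} {d} {x} {y} eq = trans (sym (++-assoc a b x)) (trans eq (++-assoc c d y))

prefixFree-++ : {A B : Set} {d : A → Bits} {e : B → Bits} →
                PrefixFree d → PrefixFree e → ∀ a b a′ b′ {x y} →
                (d a ++ e b) ++ x ≡ (d a′ ++ e b′) ++ y →
                a ≡ a′ × b ≡ b′ × x ≡ y
prefixFree-++ {d = d} {e} pd pe a b a′ b′ eq
  with pd a a′ (reassoc (d a) (d a′) eq)
... | refl , eq′ with pe b b′ eq′
... | refl , refl = refl , refl , refl

prefixFree-ℕ : PrefixFree encodeℕ
prefixFree-ℕ zero    zero    refl = refl , refl
prefixFree-ℕ (suc m) (suc n) eq with prefixFree-ℕ m n (List.∷-injectiveʳ eq)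
... | refl , eq′ = refl , eq′

prefixFree-Fin : ∀ {w} → PrefixFree (encodeFin {w})
prefixFree-Fin zero    zero    refl = refl , refl
prefixFree-Fin (suc i) (suc j) eq with prefixFree-Fin i j (List.∷-injectiveʳ eq)
... | refl , eq′ = refl , eq′

prefixFree-Gate : ∀ {w} → PrefixFree (encodeGate {w})
prefixFree-Gate (neg i) (neg j) eq with prefixFree-Fin i j (List.∷-injectiveʳ eq)
... | refl , eq′ = refl , eq′
prefixFree-Gate (and i j) (and i′ j′) eq
  with prefixFree-++ prefixFree-Fin prefixFree-Fin i j i′ j′ (List.∷-injectiveʳ (List.∷-injectiveʳ eq))
... | refl , refl , eq′ = refl , eq′
prefixFree-Gate (or i j) (or i′ j′) eq
  with prefixFree-++ prefixFree-Fin prefixFree-Fin i j i′ j′ (List.∷-injectiveʳ (List.∷-injectiveʳ eq))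
... | refl , refl , eq′ = refl , eq′
prefixFree-Gate (neg _)   (and _ _) ()
prefixFree-Gate (neg _)   (or _ _)  ()
prefixFree-Gate (and _ _) (neg _)   ()
prefixFree-Gate (and _ _) (or _ _)  ()
prefixFree-Gate (or _ _)  (neg _)   ()
prefixFree-Gate (or _ _)  (and _ _) ()

prefixFree-Gates : ∀ {w v v′} (gs : Gates w v) (hs : Gates w v′) {x y} →
                   encodeGates gs ++ x ≡ encodeGates hs ++ y →
                   _≡_ {A = Σ ℕ (Gates w)} (v , gs) (v′ , hs) × x ≡ y
prefixFree-Gates []       []       refl = refl , refl
prefixFree-Gates (g ∷ gs) (h ∷ hs) eq
  with prefixFree-Gate g h (reassoc (encodeGate g) (encodeGate h) (List.∷-injectiveʳ eq))
... | refl , eq′ with prefixFree-Gates gs hs eq′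
... | refl , eq″ = refl , eq″

prefixFree-Vec : {A : Set} {e : A → Bits} → PrefixFree e →
                 ∀ {n} → PrefixFree (encodeVec {n = n} e)
prefixFree-Vec pf []       []       eq = refl , eq
prefixFree-Vec {e = e} pf (a ∷ as) (b ∷ bs) eq
  with pf a b (reassoc (e a) (e b) eq)
... | refl , eq′ with prefixFree-Vec pf as bs eq′
... | refl , eq″ = refl , eq″

prefixFree-Circuit : ∀ {n m} → PrefixFree (encodeCircuit {n} {m})
prefixFree-Circuit (circuit gs os) (circuit gs′ os′) eq
  with prefixFree-Gates gs gs′ (reassoc (encodeGates gs) (encodeGates gs′) eq)
... | refl , eq′ with prefixFree-Vec prefixFree-Fin os os′ eq′
... | refl , eq″ = refl , eq″

prefixFree-toList : ∀ {n} → PrefixFree (Vec.toList {A = Bool} {n})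
prefixFree-toList []       []       eq = refl , eq
prefixFree-toList (a ∷ as) (b ∷ bs) eq
  with List.∷-injective eq
... | refl , eq′ with prefixFree-toList as bs eq′
... | refl , eq″ = refl , eq″

-- PWPP(n , m), where m is a function of n and p bounds the circuit size

record PWPPInstance (m : ℕ → ℕ) (p : Poly) : Set where
  constructor pwpp
  field
    n        : ℕ
    C        : Circuit n (m n)
    .m<n     : m n < n
    .bounded : size C ≤ ⟦ p ⟧ n

encodePWPP : ∀ {m p} → PWPPInstance m p → Bits
encodePWPP (pwpp n C _ _) = encodeℕ n ++ encodeCircuit C

encodePWPP-injective : ∀ {m p} → Injective _≡_ _≡_ (encodePWPP {m} {p})
encodePWPP-injective {x = pwpp n C _ _} {pwpp n′ C′ _ _} eq
  with prefixFree-ℕ n n′ eq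
... | refl , eq′ with prefixFree⇒injective prefixFree-Circuit {C} {C′} eq′
... | refl = refl

encodePair : ∀ {n} → Vec Bool n × Vec Bool n → Bits
encodePair (x , y) = Vec.toList x ++ Vec.toList y

encodePair-injective : ∀ {n} → Injective _≡_ _≡_ (encodePair {n})
encodePair-injective {x = x , y} {x′ , y′} eq
  with prefixFree-++ prefixFree-toList prefixFree-toList x y x′ y′ (cong (_++ []) eq)
... | refl , refl , _ = refl

PWPP : (ℕ → ℕ) → Poly → SearchProblem
PWPP m p = record
  { Instance         = PWPPInstance m p
  ; Candidate        = λ I → let open PWPPInstance I in Vec Bool n × Vec Bool n
  ; Solves           = λ I (x , y) → let open PWPPInstance I in
                         x ≢ y × eval C x ≡ eval C y
  ; encode           = encodePWPP
  ; encodeCandidate  = λ _ → encodePair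
  ; encode-injective = encodePWPP-injective
  ; encodeCandidate-injective = λ _ → encodePair-injective
  }

-- Unary Long Choice, where p bounds the size of each predicate's circuit

record UnaryLongChoiceInstance (p : Poly) : Set where
  constructor unaryLongChoice
  field
    n        : ℕ
    P        : Vec (Circuit n 1) (n ∸ 1)
    .n>0     : 0 < n
    .bounded : ∀ i → size (lookup P i) ≤ ⟦ p ⟧ n

  -- Pᵢ(a₀, …, aᵢ, x), which depends on x alone.

  predicate : Fin (n ∸ 1) → Vec Bool n → Bool
  predicate i x = Vec.head (eval (lookup P i) x)

encodeULC : ∀ {p} → UnaryLongChoiceInstance p → Bits
encodeULC (unaryLongChoice n P _ _) = encodeℕ n ++ encodeVec encodeCircuit P

encodeULC-injective : ∀ {p} → Injective _≡_ _≡_ (encodeULC {p})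
encodeULC-injective {x = unaryLongChoice n P _ _} {unaryLongChoice n′ P′ _ _} eq
  with prefixFree-ℕ n n′ eq
... | refl , eq′ with prefixFree⇒injective (prefixFree-Vec prefixFree-Circuit) {P} {P′} eq′
... | refl = refl

UnaryLongChoice : Poly → SearchProblem
UnaryLongChoice p = record
  { Instance         = UnaryLongChoiceInstance p
  ; Candidate        = λ I → let open UnaryLongChoiceInstance I in
                         Vec (Vec Bool n) (suc n)
  ; Solves           = λ I a → let open UnaryLongChoiceInstance I in
                         Unique a ×
                         (∀ i j k → toℕ i < toℕ j → toℕ i < toℕ k →
                            predicate i (lookup a j) ≡ predicate i (lookup a k))
  ; encode           = encodeULC
  ; encodeCandidate  = λ _ → encodeVec Vec.toList
  ; encode-injective = encodeULC-injective
  ; encodeCandidate-injective = λ _ → prefixFree⇒injective (prefixFree-Vec prefixFree-toList)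
  }

{-# OPTIONS --safe #-}

-- Taking Pᵢ to be the i-th output bit of C makes every Pᵢ constant on the last
-- two elements of a solution, since both come after aᵢ; they are distinct, so
-- they form a collision.  The circuits for the Pᵢ share the gates of C, so f
-- is computed by copying the gates to a work tape and replaying them in front
-- of each output index, and g by copying the last 2n bits of the solution.

module Submission where

open import Defs
open import Data.Bool using (Bool; true; false)
open import Data.Empty using (⊥-elim-irr)
open import Data.Fin using (Fin; zero; suc; toℕ; fromℕ; inject₁; pred)
open import Data.Fin.Patterns
open import Data.Fin.Properties using (toℕ<n; toℕ-fromℕ; toℕ-inject₁)
open import Data.List as List using (List; []; _∷_; _++_; _ʳ++_; length; reverse)
open import Data.List.Properties
open import Data.Maybe using (Maybe; just; nothing)
open import Data.Nat using (ℕ; zero; suc; _+_; _*_; _∸_; _≤_; _<_; z≤n; s≤s)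
open import Data.Nat.Properties
open import Data.Nat.Tactic.RingSolver using (solve-∀)
open import Data.Product using (Σ; ∃-syntax; _×_; _,_)
open import Data.Vec as Vec using (Vec; []; _∷_; lookup)
open import Data.Vec.Properties using (lookup-map; length-toList)
open import Data.Vec.Relation.Unary.Unique.Propositional.Properties using (lookup-injective)
open import Function using (_∘_)
open import Relation.Binary.PropositionalEquality

-- Time-bounded runs of a machine.

module _ {k : ℕ} (M : TM k) where

  HaltsWithin : ℕ → Config M → Bits → Set
  HaltsWithin b c w = ∃[ t ] ∃[ d ] (HaltsIn M t c d × output M d ≡ w × t ≤ b)

module _ {k : ℕ} {M : TM k} where

  halts : ∀ {c w} → step M c ≡ nothing → output M c ≡ w → HaltsWithin M 0 c w
  halts stop out = 0 , _ , halt stop , out , z≤n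

  after : ∀ {c c′ b w} → step M c ≡ just c′ →
          HaltsWithin M b c′ w → HaltsWithin M (suc b) c w
  after s (t , d , h , out , t≤b) = suc t , d , next s h , out , s≤s t≤b

  weaken : ∀ {c b b′ w} → b ≤ b′ → HaltsWithin M b c w → HaltsWithin M b′ c w
  weaken b≤b′ (t , d , h , out , t≤b) = t , d , h , out , ≤-trans t≤b b≤b′

cells : Bits → List Cell
cells = List.map just

-- The head is one cell to the right of l.  In this form, reading a symbol and
-- moving right is a definitional equality.

scan : List Cell → Cell → Bits → Tape
scan ls l bs = move right (tape ls l (cells bs))

-- The machine for f.  Its tapes are the output, the input and one work tape.

pattern copyN     = 0F
pattern gates     = 1F
pattern gate      = 2F
pattern binary    = 3F
pattern fin₂      = 4F
pattern fin₁      = 5F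
pattern back      = 6F
pattern rewind    = 7F
pattern emit      = 8F
pattern fin       = 9F
pattern rewindOut = suc 9F
pattern done      = suc (suc 9F)

-- `gates` to `fin₁` parse the gate list while copying it to the work tape; `and` and `or` share the
-- state `fin₂`, since two indices follow either tag. `back` tests for a further output index,
-- `rewind`, `emit` and `fin` write one circuit, and `rewindOut` returns to the start of the output.
δᶠ : Fin 12 → Vec Cell 3 → Maybe (Fin 12 × Vec (Cell × Move) 3)
δᶠ copyN     (o ∷ just true  ∷ w ∷ [])  = just (copyN , (just true , right) ∷ (just true , right) ∷ (w , stay) ∷ [])
-- The blank written on the work tape marks the left end of the copy of the gates; `rewind` stops
-- there.
δᶠ copyN     (o ∷ just false ∷ w ∷ [])  = just (gates , (just false , right) ∷ (just false , right) ∷ (nothing , right) ∷ [])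
δᶠ gates     (o ∷ just true  ∷ w ∷ [])  = just (gate , (o , stay) ∷ (just true , right) ∷ (just true , right) ∷ [])
δᶠ gates     (o ∷ just false ∷ w ∷ [])  = just (back , (o , stay) ∷ (just false , right) ∷ (just false , right) ∷ [])
δᶠ gate      (o ∷ just true  ∷ w ∷ [])  = just (binary , (o , stay) ∷ (just true , right) ∷ (just true , right) ∷ [])
δᶠ gate      (o ∷ just false ∷ w ∷ [])  = just (fin₁ , (o , stay) ∷ (just false , right) ∷ (just false , right) ∷ [])
δᶠ binary    (o ∷ just b     ∷ w ∷ [])  = just (fin₂ , (o , stay) ∷ (just b , right) ∷ (just b , right) ∷ [])
δᶠ fin₂      (o ∷ just true  ∷ w ∷ [])  = just (fin₂ , (o , stay) ∷ (just true , right) ∷ (just true , right) ∷ [])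
δᶠ fin₂      (o ∷ just false ∷ w ∷ [])  = just (fin₁ , (o , stay) ∷ (just false , right) ∷ (just false , right) ∷ [])
δᶠ fin₁      (o ∷ just true  ∷ w ∷ [])  = just (fin₁ , (o , stay) ∷ (just true , right) ∷ (just true , right) ∷ [])
δᶠ fin₁      (o ∷ just false ∷ w ∷ [])  = just (gates , (o , stay) ∷ (just false , right) ∷ (just false , right) ∷ [])
δᶠ back      (o ∷ just b     ∷ w ∷ [])  = just (rewind , (o , stay) ∷ (just b , stay) ∷ (w , left) ∷ [])
-- No count of output indices is kept: a blank under the input head means that the input is used up.
δᶠ back      (o ∷ nothing    ∷ w ∷ [])  = just (rewindOut , (o , left) ∷ (nothing , stay) ∷ (w , stay) ∷ [])
δᶠ rewind    (o ∷ i ∷ just b  ∷ [])     = just (rewind , (o , stay) ∷ (i , stay) ∷ (just b , left) ∷ [])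
δᶠ rewind    (o ∷ i ∷ nothing ∷ [])     = just (emit , (o , stay) ∷ (i , stay) ∷ (nothing , right) ∷ [])
δᶠ emit      (o ∷ i ∷ just b  ∷ [])     = just (emit , (just b , right) ∷ (i , stay) ∷ (just b , right) ∷ [])
δᶠ emit      (o ∷ i ∷ nothing ∷ [])     = just (fin , (o , stay) ∷ (i , stay) ∷ (nothing , stay) ∷ [])
δᶠ fin       (o ∷ just true  ∷ w ∷ [])  = just (fin , (just true , right) ∷ (just true , right) ∷ (w , stay) ∷ [])
δᶠ fin       (o ∷ just false ∷ w ∷ [])  = just (back , (just false , right) ∷ (just false , right) ∷ (w , stay) ∷ [])
δᶠ rewindOut (just b  ∷ i ∷ w ∷ [])     = just (rewindOut , (just b , left) ∷ (i , stay) ∷ (w , stay) ∷ [])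
δᶠ rewindOut (nothing ∷ i ∷ w ∷ [])     = just (done , (nothing , right) ∷ (i , stay) ∷ (w , stay) ∷ [])
δᶠ _         _                          = nothing

Mᶠ : TM 1
Mᶠ = record { work = 1 ; states = 12 ; start = copyN ; δ = δᶠ }

-- Runs of the machine for `f`, phase by phase.

-- `acc` holds the symbols written so far, latest first.
outTape : Bits → Tape
outTape acc = tape (cells acc) nothing []

conf : Fin 12 → Tape → Tape → Tape → Config Mᶠ
conf q o i w = q , o ∷ i ∷ w ∷ []

-- In continuation-passing form, phases compose and their time bounds add up. The continuation
-- accepts any `ls` and `l`, because the input head never moves left.
Copies : Fin 12 → Bits → Fin 12 → Set
Copies q u q′ = ∀ {o ws X b out} →
  (∀ ls l → HaltsWithin Mᶠ b (conf q′ o (scan ls l X) (tape (cells u ʳ++ ws) nothing [])) out) →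
  ∀ ls l → HaltsWithin Mᶠ (length u + b) (conf q o (scan ls l (u ++ X)) (tape ws nothing [])) out

copies-++ : ∀ {q q′ q″} u {v} → Copies q u q′ → Copies q′ v q″ → Copies q (u ++ v) q″
copies-++ u {v} cu cv {ws = ws} {X} {b} k ls l
  rewrite ++-assoc u v X | length-++ u {v} | +-assoc (length u) (length v) b
        | map-++ just u v | ++-ʳ++ (cells u) {cells v} {ws}
  = cu (cv k) ls l

copies-gates-[] : Copies gates (false ∷ []) back
copies-gates-[] k ls l = after refl (k _ _)

copies-gates-∷ : Copies gates (true ∷ []) gate
copies-gates-∷ k ls l = after refl (k _ _)

copies-neg : Copies gate (false ∷ []) fin₁
copies-neg k ls l = after refl (k _ _)

copies-binary : ∀ b → Copies gate (true ∷ b ∷ []) fin₂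
copies-binary b k ls l = after refl (after refl (k _ _))

copies-fin₁ : ∀ n → Copies fin₁ (encodeℕ n) gates
copies-fin₁ zero    k ls l = after refl (k _ _)
copies-fin₁ (suc n) k ls l = after refl (copies-fin₁ n k _ _)

copies-fin₂ : ∀ n → Copies fin₂ (encodeℕ n) fin₁
copies-fin₂ zero    k ls l = after refl (k _ _)
copies-fin₂ (suc n) k ls l = after refl (copies-fin₂ n k _ _)

-- A finite control suffices: the tag of a gate tells how many unary indices follow, and each index
-- ends at its own `false`.
copies-gate : ∀ {w} (g : Gate w) → Copies gate (encodeGate g) gates
copies-gate (neg i)   = copies-++ (false ∷ []) copies-neg (copies-fin₁ (toℕ i))
copies-gate (and i j) = copies-++ (true ∷ false ∷ []) (copies-binary false)
  (copies-++ (encodeFin i) (copies-fin₂ (toℕ i)) (copies-fin₁ (toℕ j)))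
copies-gate (or i j)  = copies-++ (true ∷ true ∷ []) (copies-binary true)
  (copies-++ (encodeFin i) (copies-fin₂ (toℕ i)) (copies-fin₁ (toℕ j)))

copies-gates : ∀ {w v} (gs : Gates w v) → Copies gates (encodeGates gs) back
copies-gates []       = copies-gates-[]
copies-gates (g ∷ gs) = copies-++ (true ∷ []) copies-gates-∷
  (copies-++ (encodeGate g) (copies-gate g) (copies-gates gs))

copyN-runs : ∀ n {acc X b out} →
  (∀ ls l → HaltsWithin Mᶠ b
     (conf gates (outTape (encodeℕ n ʳ++ acc)) (scan ls l X) (tape (nothing ∷ []) nothing [])) out) →
  ∀ ls l → HaltsWithin Mᶠ (length (encodeℕ n) + b)
     (conf copyN (outTape acc) (scan ls l (encodeℕ n ++ X)) (tape [] nothing [])) out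
copyN-runs zero    k ls l = after refl (k _ _)
copyN-runs (suc n) k ls l = after refl (copyN-runs n k _ _)

-- The first step is separate because the initial tape has no cell left of the head, so it is not of
-- the form `scan ls l bs`.
copyN-starts : ∀ n {X b out} →
  (∀ ls l → HaltsWithin Mᶠ b
     (conf gates (outTape (encodeℕ n ʳ++ [])) (scan ls l X) (tape (nothing ∷ []) nothing [])) out) →
  HaltsWithin Mᶠ (length (encodeℕ n) + b) (initial Mᶠ ((encodeℕ n ++ X) ∷ [])) out
copyN-starts zero    k = after refl (k _ _)
copyN-starts (suc n) k = after refl (copyN-runs n k _ _)

fin-runs : ∀ n {acc X b out w} →
  (∀ ls l → HaltsWithin Mᶠ b (conf back (outTape (encodeℕ n ʳ++ acc)) (scan ls l X) w) out) →
  ∀ ls l → HaltsWithin Mᶠ (length (encodeℕ n) + b)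
     (conf fin (outTape acc) (scan ls l (encodeℕ n ++ X)) w) out
fin-runs zero    k ls l = after refl (k _ _)
fin-runs (suc n) k ls l = after refl (fin-runs n k _ _)

rewind-runs : ∀ xs {c rs o i b out} →
  HaltsWithin Mᶠ b (conf emit o i (move right (tape [] nothing (cells xs ʳ++ c ∷ rs)))) out →
  HaltsWithin Mᶠ (suc (length xs + b))
     (conf rewind o i (move left (tape (cells xs ++ nothing ∷ []) c rs))) out
rewind-runs []       k = after refl k
rewind-runs (x ∷ xs) k = after refl (rewind-runs xs k)

emit-runs : ∀ xs {acc ls l i b out} →
  HaltsWithin Mᶠ b (conf fin (outTape (xs ʳ++ acc)) i (tape (cells xs ʳ++ l ∷ ls) nothing [])) out →
  HaltsWithin Mᶠ (suc (length xs + b))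
     (conf emit (outTape acc) i (move right (tape ls l (cells xs ++ nothing ∷ [])))) out
emit-runs []       k = after refl k
emit-runs (x ∷ xs) k = after refl (emit-runs xs k)

rewindOut-runs : ∀ xs {c rs i w} →
  HaltsWithin Mᶠ (suc (length xs))
     (conf rewindOut (move left (tape (cells xs) c rs)) i w) (xs ʳ++ untilBlank (c ∷ rs))
rewindOut-runs []       = after refl (halts refl refl)
rewindOut-runs (x ∷ xs) = after refl (rewindOut-runs xs)

-- The code of a number is never empty, so some bit lies under the input head; the case split
-- exposes it.
back-step : ∀ n {o ls l X w} →
  step Mᶠ (conf back o (scan ls l (encodeℕ n ++ X)) w) ≡
  just (conf rewind o (scan ls l (encodeℕ n ++ X)) (move left w))
back-step zero    = refl
back-step (suc n) = refl

cells-ʳ++ : ∀ xs {zs} → cells xs ʳ++ zs ≡ cells (reverse xs) ++ zs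
cells-ʳ++ xs {zs} = trans (ʳ++-defn (cells xs)) (cong (_++ zs) (sym (map-ʳ++ just xs)))

cells-reverse-ʳ++ : ∀ xs {zs} → cells (reverse xs) ʳ++ zs ≡ cells xs ++ zs
cells-reverse-ʳ++ xs {zs} =
  trans (cong (_ʳ++ zs) (map-ʳ++ just xs)) (ʳ++-ʳ++ (cells xs))

-- The copy lies reversed to the left of the head, so the loop runs over `reverse W`, and passing
-- over it restores the order of `W`.
rewind-copy : ∀ W {o i b out} →
  HaltsWithin Mᶠ b (conf emit o i (move right (tape [] nothing (cells W ++ nothing ∷ [])))) out →
  HaltsWithin Mᶠ (suc (length W + b))
     (conf rewind o i (move left (tape (cells W ʳ++ nothing ∷ []) nothing []))) out
rewind-copy W {o} {i} {b} {out} k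
  rewrite cells-ʳ++ W {nothing ∷ []} | sym (length-reverse W) =
  rewind-runs (reverse W)
    (subst (λ t → HaltsWithin Mᶠ b (conf emit o i (move right (tape [] nothing t))) out)
           (sym (cells-reverse-ʳ++ W)) k)

-- The work tape `w` ends as it began, ready for the next output index.
replay-runs : ∀ W n {acc X b out} →
  let w = tape (cells W ʳ++ nothing ∷ []) nothing [] in
  (∀ ls l → HaltsWithin Mᶠ b (conf back (outTape (encodeℕ n ʳ++ W ʳ++ acc)) (scan ls l X) w) out) →
  ∀ ls l → HaltsWithin Mᶠ
     (suc (suc (length W + suc (length W + (length (encodeℕ n) + b)))))
     (conf back (outTape acc) (scan ls l (encodeℕ n ++ X)) w) out
replay-runs W n k ls l =
  after (back-step n) (rewind-copy W (emit-runs W (fin-runs n k ls l)))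

-- Writing one circuit per output bit.

module _ {w v : ℕ} (gs : Gates w v) where

  private
    W = encodeGates gs

  output-circuit : Fin v → Circuit w 1
  output-circuit o = circuit gs (o ∷ [])

  replays : ∀ {m} → Vec (Fin v) m → Bits
  replays os = encodeVec encodeCircuit (Vec.map output-circuit os)

  -- Per index, the gates are traversed by `rewind`, by `emit` and, as part of the output, by the
  -- final `rewindOut`, which gives the factor 3. The index itself is traversed by `fin` and by
  -- `rewindOut`, which gives the factor 2.
  replayTime : ∀ {m} → Vec (Fin v) m → ℕ
  replayTime {m} os = m * (3 + 3 * length W) + 2 * length (encodeVec encodeFin os)

  replays-run : ∀ {m} (os : Vec (Fin v) m) {acc} ls l →
    HaltsWithin Mᶠ (2 + length acc + replayTime os)
      (conf back (outTape acc) (scan ls l (encodeVec encodeFin os))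
            (tape (cells W ʳ++ nothing ∷ []) nothing []))
      (acc ʳ++ replays os)
  replays-run []       {acc} ls l =
    weaken (≤-reflexive (cong (2 +_) (sym (+-identityʳ (length acc)))))
      (after refl (rewindOut-runs acc))
  replays-run {suc m} (o ∷ os) {acc} ls l =
    subst₂ (λ t out → HaltsWithin Mᶠ t start out) time word
      (replay-runs W (toℕ o) (replays-run os) ls l)
    where
    O = encodeFin o
    V = encodeVec encodeFin os

    start = conf back (outTape acc) (scan ls l (O ++ V))
                 (tape (cells W ʳ++ nothing ∷ []) nothing [])

    word : (O ʳ++ W ʳ++ acc) ʳ++ replays os ≡ acc ʳ++ replays (o ∷ os)
    word = begin
      (O ʳ++ W ʳ++ acc) ʳ++ replays os    ≡⟨ ʳ++-ʳ++ O ⟩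
      (W ʳ++ acc) ʳ++ (O ++ replays os)   ≡⟨ ʳ++-ʳ++ W ⟩
      acc ʳ++ (W ++ O ++ replays os)
        -- The code of a vector with a single output index is `O ++ []`.
        ≡⟨ cong (λ u → acc ʳ++ (W ++ u ++ replays os)) (++-identityʳ O) ⟨
      acc ʳ++ (W ++ (O ++ []) ++ replays os)
        ≡⟨ cong (acc ʳ++_) (++-assoc W (O ++ []) _) ⟨
      acc ʳ++ replays (o ∷ os)            ∎
      where open ≡-Reasoning

    arith : ∀ w o a m v →
      suc (suc (w + suc (w + (o + (2 + (o + (w + a)) + (m * (3 + 3 * w) + 2 * v)))))) ≡
      2 + a + ((1 + m) * (3 + 3 * w) + 2 * (o + v))
    arith = solve-∀

    time : suc (suc (length W + suc (length W + (length O + (2 + length (O ʳ++ W ʳ++ acc) + replayTime os)))))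
           ≡ 2 + length acc + replayTime (o ∷ os)
    time rewrite length-ʳ++ O {W ʳ++ acc} | length-ʳ++ W {acc} | length-++ O {V} =
      arith (length W) (length O) (length acc) m (length V)

length-encodeℕ : ∀ n → length (encodeℕ n) ≡ suc n
length-encodeℕ zero    = refl
length-encodeℕ (suc n) = cong suc (length-encodeℕ n)

-- Each index takes at least one symbol, so the input length bounds the number of replays.
vec-length≤ : ∀ {v m} (os : Vec (Fin v) m) → m ≤ length (encodeVec encodeFin os)
vec-length≤ []       = z≤n
vec-length≤ (o ∷ os) rewrite length-++ (encodeFin o) {encodeVec encodeFin os} =
  +-mono-≤ (subst (1 ≤_) (sym (length-encodeℕ (toℕ o))) (s≤s z≤n)) (vec-length≤ os)

-- The map `f` and its running time.

module _ {p : Poly} where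

  -- There are exactly as many output bits as predicates, and each predicate keeps the whole gate
  -- list, so the same `p` bounds its size.
  P-of : PWPPInstance (_∸ 1) p → UnaryLongChoiceInstance p
  P-of (pwpp n (circuit gs os) m<n size≤) = unaryLongChoice n
    (Vec.map (output-circuit gs) os)
    (≤-<-trans z≤n m<n)
    (λ i → subst (λ c → size c ≤ ⟦ p ⟧ n) (sym (lookup-map i (output-circuit gs) os)) size≤)

  P-of-polyTime : PolyTime (λ I → encodePWPP I ∷ []) (encodeULC ∘ P-of)
  -- For input length `L` the bound is `2 + 2 * L + 3 * L + 3 * L * L`: the last term pays for
  -- replaying the gates, the one before it for the constant cost per output index.
  P-of-polyTime = Mᶠ , 2 ∷ 5 ∷ 3 ∷ [] , runs
    where
    runs : ∀ I → HaltsWithin Mᶠ (⟦ 2 ∷ 5 ∷ 3 ∷ [] ⟧ (totalLength (encodePWPP I ∷ [])))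
                   (initial Mᶠ (encodePWPP I ∷ [])) (encodeULC (P-of I))
    runs (pwpp n (circuit gs os) _ _) =
      subst (HaltsWithin Mᶠ _ _) (ʳ++-ʳ++ (encodeℕ n))
        (weaken bound
          (copyN-starts n (copies-gates gs (replays-run gs os))))
      where
      N = encodeℕ n
      W = encodeGates gs
      V = encodeVec encodeFin os

      L = length N + (length W + length V) + 0

      exact : ∀ x w v m →
        x + (w + (2 + (x + 0) + (m * (3 + 3 * w) + 2 * v))) ≡ 2 + (2 * x + w + 2 * v) + 3 * m + 3 * m * w
      exact = solve-∀

      generous : ∀ l → 2 + 2 * l + 3 * l + 3 * l * l ≡ 2 + l * (5 + l * (3 + l * 0))
      generous = solve-∀

      doubled : ∀ x w v → 2 * x + w + 2 * v + w ≡ 2 * (x + (w + v) + 0)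
      doubled = solve-∀

      linear : 2 * length N + length W + 2 * length V ≤ 2 * L
      linear = ≤-trans (m≤m+n _ (length W))
                       (≤-reflexive (doubled (length N) (length W) (length V)))

      V≤L : length V ≤ L
      V≤L = ≤-trans (m≤n+m _ (length W)) (≤-trans (m≤n+m _ (length N)) (m≤m+n _ 0))

      W≤L : length W ≤ L
      W≤L = ≤-trans (m≤m+n _ (length V)) (≤-trans (m≤n+m _ (length N)) (m≤m+n _ 0))

      m≤L : n ∸ 1 ≤ L
      m≤L = ≤-trans (vec-length≤ os) V≤L

      bound : length N + (length W + (2 + length (N ʳ++ []) + replayTime gs os))
              ≤ ⟦ 2 ∷ 5 ∷ 3 ∷ [] ⟧ (totalLength ((N ++ W ++ V) ∷ []))
      bound rewrite length-ʳ++ N {[]} | length-++ N {W ++ V} | length-++ W {V} = begin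
        length N + (length W + (2 + (length N + 0) + replayTime gs os))
          ≡⟨ exact (length N) (length W) (length V) (n ∸ 1) ⟩
        2 + (2 * length N + length W + 2 * length V) + 3 * (n ∸ 1) + 3 * (n ∸ 1) * length W
          ≤⟨ +-mono-≤ (+-mono-≤ (+-monoʳ-≤ 2 linear) (*-monoʳ-≤ 3 m≤L))
                      (*-mono-≤ (*-monoʳ-≤ 3 m≤L) W≤L) ⟩
        2 + 2 * L + 3 * L + 3 * L * L
          ≡⟨ generous L ⟩
        ⟦ 2 ∷ 5 ∷ 3 ∷ [] ⟧ L ∎
        where open ≤-Reasoning

-- The machine for g.  Its tapes are the output, the code of the PWPP instance
-- and the solution.  It writes its output from right to left, so the head ends
-- at the start of the output.

pattern seek   = 0F
pattern first  = 1F
pattern second = 2F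
pattern done′  = 3F

-- The unary `n` that opens the instance serves as a counter: each `true` pays for one symbol in
-- `first` and one in `second`, and the closing `false` stops the copying after `n * 2` symbols.
δᵍ : Fin 4 → Vec Cell 3 → Maybe (Fin 4 × Vec (Cell × Move) 3)
δᵍ seek   (o ∷ i ∷ just b  ∷ [])         = just (seek , (o , stay) ∷ (i , stay) ∷ (just b , right) ∷ [])
δᵍ seek   (o ∷ i ∷ nothing ∷ [])         = just (first , (o , stay) ∷ (i , stay) ∷ (nothing , left) ∷ [])
δᵍ first  (o ∷ just true  ∷ s ∷ [])      = just (second , (s , left) ∷ (just true , stay) ∷ (s , left) ∷ [])
δᵍ first  (o ∷ just false ∷ s ∷ [])      = just (done′ , (o , right) ∷ (just false , stay) ∷ (s , stay) ∷ [])
δᵍ second (o ∷ i ∷ s ∷ [])               = just (first , (s , left) ∷ (i , right) ∷ (s , left) ∷ [])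
δᵍ _      _                              = nothing

Mᵍ : TM 2
Mᵍ = record { work = 0 ; states = 4 ; start = seek ; δ = δᵍ }

-- Runs of the machine for `g`.

conf′ : Fin 4 → Tape → Tape → Tape → Config Mᵍ
conf′ q o i s = q , o ∷ i ∷ s ∷ []

untilBlank-cells : ∀ bs → untilBlank (cells bs) ≡ bs
untilBlank-cells []       = refl
untilBlank-cells (b ∷ bs) = cong (b ∷_) (untilBlank-cells bs)

contents-cells : ∀ bs → contents (move right (tape [] nothing (cells bs))) ≡ bs
contents-cells []       = refl
contents-cells (b ∷ bs) = cong (b ∷_) (untilBlank-cells bs)

seek-loops : ∀ S {o i b out ls l} →
  HaltsWithin Mᵍ b (conf′ first o i (move left (tape (cells S ʳ++ l ∷ ls) nothing []))) out →
  HaltsWithin Mᵍ (suc (length S + b)) (conf′ seek o i (scan ls l S)) out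
seek-loops []      k = after refl k
seek-loops (b ∷ S) k = after refl (seek-loops S k)

seek-runs : ∀ S {o i b out} →
  HaltsWithin Mᵍ b (conf′ first o i (move left (tape (cells S ʳ++ []) nothing []))) out →
  HaltsWithin Mᵍ (suc (length S + b)) (conf′ seek o i (initialTape S)) out
seek-runs []      k = after refl k
seek-runs (b ∷ S) k = after refl (seek-loops S k)

-- Invariant of the loop: `ys` is already written to the right of the output head, and `zs` is still
-- to be copied, in the order in which the head moving left meets it.
first-loops : ∀ n zs {ys before c rs ls l X} → length zs ≡ n * 2 →
  HaltsWithin Mᵍ (suc (n * 2))
    (conf′ first (tape [] nothing (cells ys)) (scan ls l (encodeℕ n ++ X))
           (move left (tape (cells zs ++ before) c rs)))
    (zs ʳ++ ys)
first-loops zero    []            {ys} eq = after refl (halts refl (contents-cells ys))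
first-loops (suc n) (z ∷ z′ ∷ zs)      eq =
  after refl (after refl (first-loops n zs (suc-injective (suc-injective eq))))

first-runs : ∀ n zs {before c rs X} → length zs ≡ n * 2 →
  HaltsWithin Mᵍ (suc (n * 2))
    (conf′ first (tape [] nothing []) (initialTape (encodeℕ n ++ X))
           (move left (tape (cells zs ++ before) c rs)))
    (reverse zs)
first-runs zero    []            eq = after refl (halts refl refl)
first-runs (suc n) (z ∷ z′ ∷ zs) eq =
  after refl (after refl (first-loops n zs (suc-injective (suc-injective eq))))

-- The last two elements of a solution.

-- The indices are the forms to which `pred (fromℕ (suc m))` and `fromℕ (suc m)` reduce.
encodeVec-lastTwo : ∀ {n} m (s : Vec (Vec Bool n) (2 + m)) →
  ∃[ u ] encodeVec Vec.toList s ≡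
         u ++ encodePair (lookup s (inject₁ (fromℕ m)) , lookup s (suc (fromℕ m)))
encodeVec-lastTwo zero    (x ∷ y ∷ []) =
  [] , cong (Vec.toList x ++_) (++-identityʳ (Vec.toList y))
encodeVec-lastTwo (suc m) (x ∷ s) with encodeVec-lastTwo m s
... | u , eq = Vec.toList x ++ u ,
  trans (cong (Vec.toList x ++_) eq) (sym (++-assoc (Vec.toList x) u _))

-- For n = 0, which no instance has, the two elements coincide.

lastTwo : ∀ {n} → Vec (Vec Bool n) (suc n) → Vec Bool n × Vec Bool n
lastTwo {n} s = lookup s (pred (fromℕ n)) , lookup s (fromℕ n)

lastTwo-suffix : ∀ {n} (s : Vec (Vec Bool n) (suc n)) →
  ∃[ u ] encodeVec Vec.toList s ≡ u ++ encodePair (lastTwo s)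
lastTwo-suffix {zero}  ([] ∷ []) = [] , refl
lastTwo-suffix {suc n} s         = encodeVec-lastTwo n s

length-encodePair : ∀ {n} (xy : Vec Bool n × Vec Bool n) → length (encodePair xy) ≡ n * 2
length-encodePair {n} (x , y) = begin
  length (Vec.toList x ++ Vec.toList y)           ≡⟨ length-++ (Vec.toList x) ⟩
  length (Vec.toList x) + length (Vec.toList y)   ≡⟨ cong₂ _+_ (length-toList x) (length-toList y) ⟩
  n + n                                           ≡⟨ twice n ⟩
  n * 2                                           ∎
  where
  open ≡-Reasoning
  twice : ∀ n → n + n ≡ n * 2
  twice = solve-∀

module _ {p : Poly} where

  lastTwo-polyTime : PolyTime {D = Σ (PWPPInstance (_∸ 1) p) λ I →
                                     let open PWPPInstance I in Vec (Vec Bool n) (suc n)}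
                       (λ (I , s) → encodePWPP I ∷ encodeVec Vec.toList s ∷ [])
                       (λ (I , s) → encodePair (lastTwo s))
  lastTwo-polyTime = Mᵍ , 2 ∷ 2 ∷ [] , runs
    where
    runs : ∀ ((I , s) : Σ (PWPPInstance (_∸ 1) p) λ I →
                          let open PWPPInstance I in Vec (Vec Bool n) (suc n)) →
      let inputs = encodePWPP I ∷ encodeVec Vec.toList s ∷ [] in
      HaltsWithin Mᵍ (⟦ 2 ∷ 2 ∷ [] ⟧ (totalLength inputs)) (initial Mᵍ inputs)
                  (encodePair (lastTwo s))
    runs (pwpp n C _ _ , s) with lastTwo-suffix s
    ... | u , eq = weaken bound (seek-runs S copies)
      where
      S = encodeVec Vec.toList s
      E = encodePair (lastTwo s)
      N = encodeℕ n
      R = encodeCircuit C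

      -- After `seek`, the code of the last two elements is next to the head, reversed, with the
      -- rest of the solution beyond it.
      split : cells S ʳ++ [] ≡ cells (reverse E) ++ (cells u ʳ++ [])
      split = begin
        cells S ʳ++ []                        ≡⟨ cong (λ t → cells t ʳ++ []) eq ⟩
        cells (u ++ E) ʳ++ []                 ≡⟨ cong (_ʳ++ []) (map-++ just u E) ⟩
        (cells u ++ cells E) ʳ++ []           ≡⟨ ++-ʳ++ (cells u) ⟩
        cells E ʳ++ (cells u ʳ++ [])          ≡⟨ cells-ʳ++ E ⟩
        cells (reverse E) ++ (cells u ʳ++ []) ∎
        where open ≡-Reasoning

      copies : HaltsWithin Mᵍ (suc (n * 2))
        (conf′ first (tape [] nothing []) (initialTape (N ++ R))
               (move left (tape (cells S ʳ++ []) nothing []))) E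
      copies = subst₂
        (λ t out → HaltsWithin Mᵍ (suc (n * 2))
           (conf′ first (tape [] nothing []) (initialTape (N ++ R)) (move left (tape t nothing []))) out)
        (sym split) (reverse-involutive E)
        (first-runs n (reverse E) (trans (length-reverse E) (length-encodePair (lastTwo s))))

      -- The summand `2 + r + r + s` is the slack between the running time and the bound.
      arith : ∀ n r s → suc (s + suc (n * 2)) + (2 + r + r + s) ≡ 2 + (suc n + r + (s + 0)) * (2 + (suc n + r + (s + 0)) * 0)
      arith = solve-∀

      bound : suc (length S + suc (n * 2)) ≤ ⟦ 2 ∷ 2 ∷ [] ⟧ (totalLength ((N ++ R) ∷ S ∷ []))
      bound rewrite length-++ N {R} | length-encodeℕ n =
        ≤-trans (m≤m+n _ _) (≤-reflexive (arith n (length R) (length S)))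

-- The last two elements collide.

map-lookup-cong : ∀ {A B : Set} {f g : A → B} {n} (xs : Vec A n) →
  (∀ i → f (lookup xs i) ≡ g (lookup xs i)) → Vec.map f xs ≡ Vec.map g xs
map-lookup-cong []       eq = refl
map-lookup-cong (x ∷ xs) eq = cong₂ _∷_ (eq zero) (map-lookup-cong xs (eq ∘ suc))

module _ {p : Poly} where

  lastTwo-correct : ∀ (I : PWPPInstance (_∸ 1) p) s →
    SearchProblem.Solves (UnaryLongChoice p) (P-of I) s →
    SearchProblem.Solves (PWPP (_∸ 1) p) I (lastTwo s)
  -- Here `m<n` would say `0 < 0`.
  lastTwo-correct (pwpp zero _ m<n _) s _ = ⊥-elim-irr (n≮0 m<n)
  lastTwo-correct (pwpp (suc n) (circuit gs os) _ _) s (unique , constant) =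
    distinct , map-lookup-cong os agree
    where
    toℕ-penultimate : toℕ (inject₁ (fromℕ n)) ≡ n
    toℕ-penultimate = trans (toℕ-inject₁ (fromℕ n)) (toℕ-fromℕ n)

    distinct : lookup s (inject₁ (fromℕ n)) ≢ lookup s (suc (fromℕ n))
    distinct eq = 1+n≢n (begin
      suc n                     ≡⟨ cong suc (toℕ-fromℕ n) ⟨
      toℕ (suc (fromℕ n))       ≡⟨ cong toℕ (lookup-injective unique _ _ eq) ⟨
      toℕ (inject₁ (fromℕ n))   ≡⟨ toℕ-penultimate ⟩
      n                         ∎)
      where open ≡-Reasoning

    agree : ∀ i → lookup (evalGates gs (lookup s (inject₁ (fromℕ n)))) (lookup os i)
                ≡ lookup (evalGates gs (lookup s (suc (fromℕ n)))) (lookup os i)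
    agree i = subst (λ c → Vec.head (eval c (lookup s (inject₁ (fromℕ n))))
                         ≡ Vec.head (eval c (lookup s (suc (fromℕ n)))))
      (lookup-map i (output-circuit gs) os)
      -- With `suc n` input bits there are `n` predicates, so `i` lies below `n`, and both
      -- positions, `n` and `suc n`, come strictly after it.
      (constant i _ _
        (subst (toℕ i <_) (sym toℕ-penultimate) (toℕ<n i))
        (subst (λ m → toℕ i < suc m) (sym (toℕ-fromℕ n)) (m<n⇒m<1+n (toℕ<n i))))

theorem3 : ∀ (p : Poly) → ∃[ q ] (PWPP (λ n → n ∸ 1) p ≤ₚ UnaryLongChoice q)
theorem3 p = p , record
  { f          = P-of
  ; g          = λ _ → lastTwo
  ; f-polyTime = P-of-polyTime
  ; g-polyTime = lastTwo-polyTime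
  ; correct    = lastTwo-correct
  }
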